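{- Let $R$ be a finite Frobenius ring, let $V=R^n$, and let $G$ be a finite permutation group on the coordinates of $V$. Let $H$ be a subgroup of $G$ such that $|H|$ has an inverse in $R$. If $C$ is a (left or right) $G$-code of length $n$ over $R$, then $${}^{\perp_H}(C\theta_H) = \bigl(({}^{\perp}C)\theta_H\bigr) M_H,$$ where $M_H$ is the $H$-orbit length matrix.
   Context: A finite (associative, unital) ring $R$ is Frobenius if $R/\mathrm{Rad}(R)\cong \mathrm{Soc}(R_R)$ as right $R$-modules and $R/\mathrm{Rad}(R)\cong\mathrm{Soc}({}_RR)$ as left $R$-modules. $R$ need not be commutative. On $V=R^n$ put $(u,v):=u_1v_1+\cdots+u_nv_n$. A permutation group $G$ on $\{1,\dots,n\}$ acts on $V$ on the right by $(vg)_i = v_{ig^{ -1}}$. A left (right) $G$-code is a left (right) $R$-submodule $C$ of $V$ with $Cg\subseteq C$ for all $g\in G$. "$|H|$ has an inverse in $R$" means $|H|\cdot 1_R$ is a unit. Define $v\theta_H:=\frac1{|H|}\sum_{h\in H}vh$ for $v\in V$ and $X\theta_H:=\{v\theta_H:v\in X\}$ for $X\subseteq V$. For a submodule $X\subseteq V$, ${}^{\perp}X:=\{u\in V:(u,v)=0\text{ for all }v\in X\}$. Let $H_V(\alpha_1),\dots,H_V(\alpha_t)$ be the orbits of $H$ on $\{1,\dots,n\}$, $m_i$ the length (cardinality) of $H_V(\alpha_i)$, and $\overline{H_V(\alpha_i)}\in V$ the vector with entry $1$ at the positions in $H_V(\alpha_i)$ and $0$ elsewhere. Every $u\in V\theta_H$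 is uniquely $u=\sum_{i=1}^t u_i\overline{H_V(\alpha_i)}$ with $u_i\in R$. The $H$-inner product on $V\theta_H$ is $(u,v)_H:=\sum_{i=1}^t u_iv_i$, and for a submodule $X\subseteq V\theta_H$, ${}^{\perp_H}X:=\{v\in V\theta_H:(v,u)_H=0\text{ for all }u\in X\}$. The $H$-orbit length matrix is $M_H:=\mathrm{diag}(\ell_1,\dots,\ell_n)$ with $\ell_j=m_i$ if $j\in H_V(\alpha_i)$; for a set $Y\subseteq V$ of row vectors, $YM_H:=\{yM_H:y\in Y\}$. -}

module Defs where

open import Algebra.Bundles using (Ring)
open import Algebra.Definitions using (Invertible)
open import Algebra.Module.Bundles.Raw using (RawLeftModule; RawRightModule)
open import Algebra.Module.Construct.TensorUnit using (rawLeftModule; rawRightModule)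
open import Algebra.Module.Morphism.Structures
  using (module LeftModuleMorphisms; module RightModuleMorphisms)
open import Data.Bool.Base using (if_then_else_)
open import Data.Fin.Base using (Fin; zero; suc)
open import Data.Fin.Permutation as Perm
  using (Permutation′; _⟨$⟩ʳ_; _⟨$⟩ˡ_; _∘ₚ_; flip)
open import Data.Fin.Properties using (any?; suc-injective) renaming (_≟_ to _≟ᶠ_)
open import Data.Fin.Subset using (Subset; ∣_∣) renaming (_∈_ to _∈ˢ_)
open import Data.Fin.Subset.Properties using (_∈?_)
open import Data.Nat.Base using (ℕ)
open import Data.Product using (Σ; ∃; ∃!; _×_; _,_; proj₁; proj₂)
open import Data.Vec.Base using (tabulate)
open import Data.Vec.Functional using (Vector)
open import Data.Vec.Properties using (lookup∘tabulate; []=⇒lookup; lookup⇒[]=)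
open import Function.Base using (_∘_)
open import Function.Bundles using (Inverse)
open import Level using (Level; _⊔_) renaming (suc to lsuc)
open import Relation.Binary.Definitions using (_Respects_)
open import Relation.Binary.PropositionalEquality as ≡ using (_≡_; _≢_)
open import Relation.Nullary using (does; yes; no)
open import Relation.Nullary.Decidable using (dec-true; dec-false)
open import Relation.Unary using (Pred; _∈_; _∉_; _⊆_; U)

------------------------------------------------------------------------
-- Submodules, radical and socle

-- Being a submodule depends only on the additive group and on the set of
-- maps by which the scalars act, so right modules are covered as well, by
-- way of `operators` below.

module Submodules {s m ℓ} {S : Set s} (M : RawLeftModule S m ℓ) where
  open RawLeftModule M

  record IsSubmodule {p} (P : Pred Carrierᴹ p) : Set (s ⊔ m ⊔ ℓ ⊔ p) where
    field
      resp     : P Respects _≈ᴹ_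
      0-closed : 0ᴹ ∈ P
      +-closed : ∀ {x y} → x ∈ P → y ∈ P → x +ᴹ y ∈ P
      -‿closed : ∀ {x} → x ∈ P → -ᴹ x ∈ P
      *-closed : ∀ r {x} → x ∈ P → r *ₗ x ∈ P

  private
    -- Large enough to contain the submodules generated by elements of M.
    q : Level
    q = s ⊔ m ⊔ ℓ

  Proper : ∀ {p} → Pred Carrierᴹ p → Set (m ⊔ p)
  Proper P = ∃ λ x → x ∉ P

  Nonzero : ∀ {p} → Pred Carrierᴹ p → Set (m ⊔ ℓ ⊔ p)
  Nonzero P = ∃ λ x → x ∈ P × x ≉ᴹ 0ᴹ

  record IsMaximal (P : Pred Carrierᴹ q) : Set (lsuc q) where
    field
      isSubmodule : IsSubmodule P
      proper      : Proper P
      maximal     : (Q : Pred Carrierᴹ q) → IsSubmodule Q → Proper Q → P ⊆ Q → Q ⊆ P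

  record IsSimple (P : Pred Carrierᴹ q) : Set (lsuc q) where
    field
      isSubmodule : IsSubmodule P
      nonzero     : Nonzero P
      minimal     : (Q : Pred Carrierᴹ q) → IsSubmodule Q → Nonzero Q → Q ⊆ P → P ⊆ Q

  Rad : Pred Carrierᴹ (lsuc q)
  Rad x = (P : Pred Carrierᴹ q) → IsMaximal P → x ∈ P

  -- The sum of all simple submodules, as the submodule generated by their union.
  data Soc : Pred Carrierᴹ (lsuc q) where
    simple : ∀ {P} → IsSimple P → P ⊆ Soc
    resp   : Soc Respects _≈ᴹ_
    0∈     : 0ᴹ ∈ Soc
    +∈     : ∀ {x y} → x ∈ Soc → y ∈ Soc → x +ᴹ y ∈ Soc
    -∈     : ∀ {x} → x ∈ Soc → -ᴹ x ∈ Soc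
    *∈     : ∀ r {x} → x ∈ Soc → r *ₗ x ∈ Soc

operators : ∀ {s m ℓ} {S : Set s} → RawRightModule S m ℓ → RawLeftModule S m ℓ
operators M = record
  { Carrierᴹ = Carrierᴹ
  ; _≈ᴹ_     = _≈ᴹ_
  ; _+ᴹ_     = _+ᴹ_
  ; _*ₗ_     = λ r x → x *ᵣ r
  ; 0ᴹ       = 0ᴹ
  ; -ᴹ_      = -ᴹ_
  } where open RawRightModule M

------------------------------------------------------------------------
-- Finite Frobenius rings

IsFinite : ∀ {c ℓ} → Ring c ℓ → Set (c ⊔ ℓ)
IsFinite R = ∃ λ k → Inverse (Ring.setoid R) (≡.setoid (Fin k))

HasInverseIn : ∀ {c ℓ} → Ring c ℓ → ℕ → Set (c ⊔ ℓ)
HasInverseIn R k = Invertible _≈_ 1# _*_ (k ×ᴿ 1#)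
  where
  open Ring R
  open import Algebra.Properties.Semiring.Mult semiring using () renaming (_×_ to _×ᴿ_)

module Regular {c ℓ} (R : Ring c ℓ) where
  open Ring R

  private
    ᵣR : RawLeftModule Carrier c ℓ
    ᵣR = rawLeftModule {R = rawRing}

    Rᵣ : RawRightModule Carrier c ℓ
    Rᵣ = rawRightModule {R = rawRing}

  module LeftIdeals  = Submodules ᵣR
  module RightIdeals = Submodules (operators Rᵣ)

  -- The intersection of the maximal right ideals; it is also the
  -- intersection of the maximal left ideals, hence a two-sided ideal.
  JacobsonRadical : Pred Carrier (lsuc (c ⊔ ℓ))
  JacobsonRadical = RightIdeals.Rad

  -- Quotients keep the carrier and coarsen the equality.

  leftR/Rad : RawLeftModule Carrier c (lsuc (c ⊔ ℓ))
  leftR/Rad = record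
    { RawLeftModule ᵣR
    ; _≈ᴹ_ = λ x y → x - y ∈ JacobsonRadical
    }

  rightR/Rad : RawRightModule Carrier c (lsuc (c ⊔ ℓ))
  rightR/Rad = record
    { RawRightModule Rᵣ
    ; _≈ᴹ_ = λ x y → x - y ∈ JacobsonRadical
    }

  leftSocle : RawLeftModule Carrier (lsuc (c ⊔ ℓ)) ℓ
  leftSocle = record
    { Carrierᴹ = Σ Carrier Soc
    ; _≈ᴹ_     = λ (x , _) (y , _) → x ≈ y
    ; _+ᴹ_     = λ (x , x∈) (y , y∈) → x + y , +∈ x∈ y∈
    ; _*ₗ_     = λ r (x , x∈) → r * x , *∈ r x∈
    ; 0ᴹ       = 0# , 0∈
    ; -ᴹ_      = λ (x , x∈) → - x , -∈ x∈
    } where open LeftIdeals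

  rightSocle : RawRightModule Carrier (lsuc (c ⊔ ℓ)) ℓ
  rightSocle = record
    { Carrierᴹ = Σ Carrier Soc
    ; _≈ᴹ_     = λ (x , _) (y , _) → x ≈ y
    ; _+ᴹ_     = λ (x , x∈) (y , y∈) → x + y , +∈ x∈ y∈
    ; _*ᵣ_     = λ (x , x∈) r → x * r , *∈ r x∈
    ; 0ᴹ       = 0# , 0∈
    ; -ᴹ_      = λ (x , x∈) → - x , -∈ x∈
    } where open RightIdeals

record IsFrobenius {c ℓ} (R : Ring c ℓ) : Set (lsuc (c ⊔ ℓ)) where
  open Regular R
  field
    right : ∃ (RightModuleMorphisms.IsRightModuleIsomorphism rightR/Rad rightSocle)
    left  : ∃ (LeftModuleMorphisms.IsLeftModuleIsomorphism leftR/Rad leftSocle)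

------------------------------------------------------------------------
-- Permutation groups
--
-- The points are acted on from the right: ig is g ⟨$⟩ʳ i, ig⁻¹ is
-- g ⟨$⟩ˡ i, and the product gh ("first g, then h") is g ∘ₚ h.

record PermutationGroup (n : ℕ) : Set where
  infix 4 _∈ᴳ

  field
    order             : ℕ
    element           : Fin order → Permutation′ n
    element-injective : ∀ {a b} → element a Perm.≈ element b → a ≡ b

  _∈ᴳ : Permutation′ n → Set
  π ∈ᴳ = ∃ λ a → element a Perm.≈ π

  field
    id-closed   : Perm.id ∈ᴳ
    ∘-closed    : ∀ a b → element a ∘ₚ element b ∈ᴳ
    flip-closed : ∀ a → flip (element a) ∈ᴳ

  orbit : Fin n → Subset n
  orbit i = tabulate λ j → does (any? λ a → element a ⟨$⟩ʳ i ≟ᶠ j)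

open PermutationGroup using (_∈ᴳ)

infix 4 _≤ᴳ_

_≤ᴳ_ : ∀ {n} → PermutationGroup n → PermutationGroup n → Set
H ≤ᴳ G = ∀ {π} → _∈ᴳ H π → _∈ᴳ G π

-- A list orbit (α 0), …, orbit (α (t - 1)) in which every orbit occurs exactly once.

record Orbits {n} (H : PermutationGroup n) : Set where
  open PermutationGroup H
  field
    t        : ℕ
    α        : Fin t → Fin n
    cover    : ∀ j → ∃ λ i → j ∈ˢ orbit (α i)
    disjoint : ∀ {i k j} → j ∈ˢ orbit (α i) → j ∈ˢ orbit (α k) → i ≡ k

  index : Fin n → Fin t
  index j = proj₁ (cover j)

  m : Fin t → ℕ
  m i = ∣ orbit (α i) ∣

module _ {n} (H : PermutationGroup n) where
  open PermutationGroup H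

  orbit⁻ : ∀ {i j} → j ∈ˢ orbit i → ∃ λ a → element a ⟨$⟩ʳ i ≡ j
  orbit⁻ {i} {j} j∈ with any? (λ a → element a ⟨$⟩ʳ i ≟ᶠ j)
                       | ≡.trans (≡.sym (lookup∘tabulate (λ k → does (any? λ a → element a ⟨$⟩ʳ i ≟ᶠ k)) j))
                                 ([]=⇒lookup j∈)
  ... | yes p | _  = p
  ... | no  _ | ()

  orbit⁺ : ∀ {i j} a → element a ⟨$⟩ʳ i ≡ j → j ∈ˢ orbit i
  orbit⁺ {i} {j} a eq = lookup⇒[]= j (orbit i)
    (≡.trans (lookup∘tabulate _ j) (dec-true (any? λ b → element b ⟨$⟩ʳ i ≟ᶠ j) (a , eq)))

  orbit-refl : ∀ {i} → i ∈ˢ orbit i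
  orbit-refl {i} = orbit⁺ (proj₁ id-closed) (proj₂ id-closed i)

  ≈⇒≈ˡ : ∀ (π ρ : Permutation′ n) → π Perm.≈ ρ → ∀ i → π ⟨$⟩ˡ i ≡ ρ ⟨$⟩ˡ i
  ≈⇒≈ˡ π ρ π≈ρ i = ≡.trans
    (≡.cong (π ⟨$⟩ˡ_) (≡.trans (≡.sym (Perm.inverseʳ ρ)) (≡.sym (π≈ρ (ρ ⟨$⟩ˡ i)))))
    (Perm.inverseˡ π)

  rightTranslation : Fin order → Permutation′ order
  rightTranslation k = Perm.permutation to from to-from from-to
    where
    k⁻¹ : Fin order
    k⁻¹ = proj₁ (flip-closed k)

    to from : Fin order → Fin order
    to   h = proj₁ (∘-closed h k)
    from h = proj₁ (∘-closed h k⁻¹)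

    to-from : ∀ h → to (from h) ≡ h
    to-from h = element-injective λ i →
      ≡.trans (proj₂ (∘-closed (from h) k) i) (≡.trans
      (≡.cong (element k ⟨$⟩ʳ_) (≡.trans (proj₂ (∘-closed h k⁻¹) i) (proj₂ (flip-closed k) _)))
      (Perm.inverseʳ (element k)))

    from-to : ∀ h → from (to h) ≡ h
    from-to h = element-injective λ i →
      ≡.trans (proj₂ (∘-closed (to h) k⁻¹) i) (≡.trans
      (proj₂ (flip-closed k) _) (≡.trans
      (≡.cong (element k ⟨$⟩ˡ_) (proj₂ (∘-closed h k) i))
      (Perm.inverseˡ (element k))))

  rightTranslationˡ : ∀ h k i → element (rightTranslation k ⟨$⟩ʳ h) ⟨$⟩ˡ (element k ⟨$⟩ʳ i)
                                ≡ element h ⟨$⟩ˡ i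
  rightTranslationˡ h k i = ≡.trans
    (≈⇒≈ˡ (element (rightTranslation k ⟨$⟩ʳ h)) (element h ∘ₚ element k) (proj₂ (∘-closed h k)) (element k ⟨$⟩ʳ i))
    (≡.cong (element h ⟨$⟩ˡ_) (Perm.inverseˡ (element k)))

------------------------------------------------------------------------
-- G-codes in V = Rⁿ

module Codes {c ℓ} (R : Ring c ℓ) (n : ℕ) where
  open Ring R
  open import Algebra.Properties.Semiring.Sum semiring public using (sum; sum-syntax)
  open import Data.Vec.Functional.Relation.Binary.Equality.Setoid setoid public using (_≋_)

  V : Set c
  V = Vector Carrier n

  leftV : RawLeftModule Carrier c ℓ
  leftV = record
    { Carrierᴹ = V
    ; _≈ᴹ_     = _≋_
    ; _+ᴹ_     = λ u v i → u i + v i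
    ; _*ₗ_     = λ r v i → r * v i
    ; 0ᴹ       = λ _ → 0#
    ; -ᴹ_      = λ v i → - v i
    }

  rightV : RawRightModule Carrier c ℓ
  rightV = record
    { Carrierᴹ = V
    ; _≈ᴹ_     = _≋_
    ; _+ᴹ_     = λ u v i → u i + v i
    ; _*ᵣ_     = λ v r i → v i * r
    ; 0ᴹ       = λ _ → 0#
    ; -ᴹ_      = λ v i → - v i
    }

  infixl 8 _◃_

  _◃_ : V → Permutation′ n → V
  (v ◃ g) i = v (g ⟨$⟩ˡ i)

  Invariant : ∀ {p} → PermutationGroup n → Pred V p → Set (c ⊔ p)
  Invariant G C = ∀ {g} → _∈ᴳ G g → ∀ {v} → v ∈ C → v ◃ g ∈ C

  IsLeftCode : ∀ {p} → PermutationGroup n → Pred V p → Set (c ⊔ ℓ ⊔ p)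
  IsLeftCode G C = Submodules.IsSubmodule leftV C × Invariant G C

  IsRightCode : ∀ {p} → PermutationGroup n → Pred V p → Set (c ⊔ ℓ ⊔ p)
  IsRightCode G C = Submodules.IsSubmodule (operators rightV) C × Invariant G C

  ⟨_,_⟩ : V → V → Carrier
  ⟨ u , v ⟩ = ∑[ i < n ] (u i * v i)

  infix 9 ⊥_

  ⊥_ : ∀ {p} → Pred V p → Pred V (c ⊔ ℓ ⊔ p)
  (⊥ X) u = ∀ {v} → v ∈ X → ⟨ u , v ⟩ ≈ 0#

  Image : ∀ {p} → (V → V) → Pred V p → Pred V (c ⊔ ℓ ⊔ p)
  Image f X w = ∃ λ v → v ∈ X × w ≋ f v

  Matrix : Set c
  Matrix = Vector (Vector Carrier n) n

  diag : Vector Carrier n → Matrix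
  diag d i j = if does (i ≟ᶠ j) then d i else 0#

  infixl 7 _·ᴹ_ _·ˢ_

  _·ᴹ_ : V → Matrix → V
  (y ·ᴹ M) j = ∑[ i < n ] (y i * M i j)

  _·ˢ_ : ∀ {p} → Pred V p → Matrix → Pred V (c ⊔ ℓ ⊔ p)
  Y ·ˢ M = Image (_·ᴹ M) Y

------------------------------------------------------------------------
-- The map θ_H, the H-inner product and the H-orbit length matrix

module HCodes {c ℓ} (R : Ring c ℓ) {n : ℕ} (H : PermutationGroup n)
  (∣H∣-inverse : HasInverseIn R (PermutationGroup.order H)) (orbits : Orbits H) where

  open Ring R hiding (zero)
  open Codes R n
  open PermutationGroup H using (order; element; orbit)
  open Orbits orbits
  open import Algebra.Properties.Semiring.Mult semiring using () renaming (_×_ to _×ᴿ_)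
  open import Algebra.Properties.Semiring.Sum semiring using (sum-cong-≋; ∑-permute; sum-replicate-zero)

  infix 10 _θ _θˢ

  _θ : V → V
  (v θ) j = proj₁ ∣H∣-inverse * ∑[ h < order ] (v ◃ element h) j

  _θˢ : ∀ {p} → Pred V p → Pred V (c ⊔ ℓ ⊔ p)
  X θˢ = Image _θ X

  Vθ : Pred V (c ⊔ ℓ)
  Vθ = U θˢ

  Xθ⊆Vθ : ∀ {p} (X : Pred V p) → X θˢ ⊆ Vθ
  Xθ⊆Vθ X (v , _ , w≋vθ) = v , _ , w≋vθ

  orbitVector : Fin t → V
  orbitVector i j = if does (j ∈? orbit (α i)) then 1# else 0#

  IsCoefficients : V → Vector Carrier t → Set ℓ
  IsCoefficients u a = u ≋ λ j → ∑[ i < t ] (a i * orbitVector i j)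

  sum-only : ∀ {k} (f : Vector Carrier k) i → (∀ {l} → l ≢ i → f l ≈ 0#) → sum f ≈ f i
  sum-only {ℕ.suc k} f zero    z = trans
    (+-congˡ (trans (sum-cong-≋ {k} (λ l → z {suc l} λ ())) (sum-replicate-zero k)))
    (+-identityʳ _)
  sum-only {ℕ.suc k} f (suc i) z = trans
    (+-cong (z {zero} λ ()) (sum-only (f ∘ suc) i (λ l≢i → z (l≢i ∘ suc-injective))))
    (+-identityˡ _)

  -- Evaluating a combination of orbit vectors at a position of the i-th orbit.
  evaluate : ∀ (a : Vector Carrier t) {i j} → j ∈ˢ orbit (α i) →
             ∑[ l < t ] (a l * orbitVector l j) ≈ a i
  evaluate a {i} {j} j∈ = trans (sum-only (λ l → a l * orbitVector l j) i vanish)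
    (trans (*-congˡ (reflexive one)) (*-identityʳ _))
    where
    one : orbitVector i j ≡ 1#
    one = ≡.cong (if_then 1# else 0#) (dec-true (j ∈? orbit (α i)) j∈)

    vanish : ∀ {l} → l ≢ i → a l * orbitVector l j ≈ 0#
    vanish {l} l≢i = trans (*-congˡ (reflexive
      (≡.cong (if_then 1# else 0#) (dec-false (j ∈? orbit (α l)) (λ j∈l → l≢i (disjoint j∈l j∈))))))
      (zeroʳ _)

  θ-constant : ∀ v {i j} → j ∈ˢ orbit i → (v θ) j ≈ (v θ) i
  θ-constant v {i} {j} j∈ with orbit⁻ H j∈
  ... | k , ≡.refl = *-congˡ (trans
    (∑-permute (λ h → (v ◃ element h) j) (rightTranslation H k))
    (sum-cong-≋ {order} (λ h → reflexive (≡.cong v (rightTranslationˡ H h k i)))))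

  decompose : ∀ {u} → u ∈ Vθ → ∃! _≋_ (IsCoefficients u)
  decompose {u} (v , _ , u≋vθ) = (λ i → u (α i)) , exists , unique
    where
    exists : IsCoefficients u (λ i → u (α i))
    exists j = let i , j∈ = cover j in
      trans (u≋vθ j) (trans (θ-constant v j∈) (trans (sym (u≋vθ (α i)))
        (sym (evaluate (λ i → u (α i)) j∈))))

    unique : ∀ {a} → IsCoefficients u a → (λ i → u (α i)) ≋ a
    unique {a} u≋ i = trans (u≋ (α i)) (evaluate a (orbit-refl H))

  coefficients : ∀ {u} → u ∈ Vθ → Vector Carrier t
  coefficients u∈ = proj₁ (decompose u∈)

  -- The arguments are the proofs that the two vectors lie in Vθ.
  ⟨_,_⟩ᴴ : ∀ {u v} → u ∈ Vθ → v ∈ Vθ → Carrier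
  ⟨ u∈ , v∈ ⟩ᴴ = ∑[ i < t ] (coefficients u∈ i * coefficients v∈ i)

  ⊥ᴴ : ∀ {p} (X : Pred V p) → X ⊆ Vθ → Pred V (c ⊔ ℓ ⊔ p)
  ⊥ᴴ X X⊆Vθ v = Σ (v ∈ Vθ) λ v∈ → ∀ {u} (u∈X : u ∈ X) → ⟨ v∈ , X⊆Vθ u∈X ⟩ᴴ ≈ 0#

  orbitLengthMatrix : Matrix
  orbitLengthMatrix = diag λ j → m (index j) ×ᴿ 1#

{-# OPTIONS --safe #-}

-- If f is constant on the orbits of H, then f θ = f, ⟨ u θ , f ⟩ = ⟨ u , f ⟩ for
-- all u, and the sum of f over all positions is Σᵢ mᵢ f(αᵢ). Hence ⟨ w , c ⟩ for orbit-constant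
-- w equals Σᵢ mᵢ w(αᵢ) (c θ)(αᵢ), which is the H-inner product of w M_H and c θ.
-- The matrix M_H is invertible on V θ because θ applied to the unit vector at αᵢ
-- has the inverse of mᵢ as its entry at αᵢ.

module Submission where

open import Algebra.Bundles using (Ring)
open import Data.Bool.Base using (if_then_else_)
open import Data.Fin.Base using (Fin)
open import Data.Fin.Permutation using (_⟨$⟩ʳ_; _⟨$⟩ˡ_; flip; inverseʳ)
open import Data.Fin.Properties using () renaming (_≟_ to _≟ᶠ_)
open import Data.Fin.Subset using (Subset; inside; outside; ∣_∣) renaming (_∈_ to _∈ˢ_)
open import Data.Fin.Subset.Properties using (_∈?_)
open import Data.Nat.Base using (ℕ)
open import Data.Product using (_,_; proj₁; proj₂)
open import Data.Sum.Base using (_⊎_; inj₁; inj₂)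
open import Data.Unit.Base using (tt)
open import Data.Vec.Base using ([]; _∷_)
open import Relation.Binary.PropositionalEquality as ≡ using (_≡_; _≢_)
open import Relation.Nullary using (does; yes; no)
open import Relation.Nullary.Decidable using (dec-true; dec-false)
open import Relation.Unary using (Pred; _∈_; _⊆_; _≐_)
open import Defs

-- Integer multiples of `1#` and their inverses in a noncommutative ring.

module _ {c ℓ} (R : Ring c ℓ) where
  open Ring R
  open import Algebra.Properties.Semiring.Mult semiring using (×-comm-*; ×-assoc-*; ×-congʳ)
    renaming (_×_ to _×ᴿ_)
  open import Algebra.Properties.Semiring.Sum semiring using (sum-syntax)
  open import Relation.Binary.Reasoning.Setoid setoid

  ×1-* : ∀ k x → (k ×ᴿ 1#) * x ≈ k ×ᴿ x
  ×1-* k x = trans (×-assoc-* k 1# x) (×-congʳ k (*-identityˡ x))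

  *-×1 : ∀ k x → x * (k ×ᴿ 1#) ≈ k ×ᴿ x
  *-×1 k x = trans (×-comm-* k x 1#) (×-congʳ k (*-identityʳ x))

  ×1-central : ∀ k x → (k ×ᴿ 1#) * x ≈ x * (k ×ᴿ 1#)
  ×1-central k x = trans (×1-* k x) (sym (*-×1 k x))

  -- Multiply by `z * z⁻¹` on the right, then carry `z` leftwards across `x` until it cancels the
  -- first `z⁻¹`. This lets the factor 1/|H| in `θ` pass through products of entries.
  inverse-central : ∀ {z z⁻¹} → z⁻¹ * z ≈ 1# → z * z⁻¹ ≈ 1# →
                    (∀ x → z * x ≈ x * z) → ∀ x → z⁻¹ * x ≈ x * z⁻¹
  inverse-central {z} {z⁻¹} z⁻¹z zz⁻¹ central x = begin
    z⁻¹ * x               ≈⟨ *-identityʳ _ ⟨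
    z⁻¹ * x * 1#          ≈⟨ *-congˡ zz⁻¹ ⟨
    z⁻¹ * x * (z * z⁻¹)   ≈⟨ *-assoc _ _ _ ⟨
    z⁻¹ * x * z * z⁻¹     ≈⟨ *-congʳ (*-assoc _ _ _) ⟩
    z⁻¹ * (x * z) * z⁻¹   ≈⟨ *-congʳ (*-congˡ (central x)) ⟨
    z⁻¹ * (z * x) * z⁻¹   ≈⟨ *-congʳ (*-assoc _ _ _) ⟨
    z⁻¹ * z * x * z⁻¹     ≈⟨ *-congʳ (trans (*-congʳ z⁻¹z) (*-identityˡ x)) ⟩
    x * z⁻¹               ∎

  sum-indicator : ∀ {k} (p : Subset k) →
                  ∑[ j < k ] (if does (j ∈? p) then 1# else 0#) ≈ ∣ p ∣ ×ᴿ 1#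
  sum-indicator []            = refl
  sum-indicator (inside  ∷ p) = +-congˡ (sum-indicator p)
  sum-indicator (outside ∷ p) = trans (+-identityˡ _) (sum-indicator p)

-- Averaging over `H` and vectors constant on orbits.

module _ {c ℓ} (R : Ring c ℓ) {n : ℕ} (H : PermutationGroup n)
  (∣H∣-inverse : HasInverseIn R (PermutationGroup.order H)) (orbits : Orbits H) where

  open Ring R
  open Codes R n
  open HCodes R H ∣H∣-inverse orbits
  open PermutationGroup H using (order; element; orbit)
  open Orbits orbits
  open import Algebra.Properties.Semiring.Mult semiring using (×-assoc-*)
    renaming (_×_ to _×ᴿ_)
  open import Algebra.Properties.Semiring.Sum semiring
    using (sum-cong-≋; ∑-permute; ∑-comm; sum-replicate; sum-replicate-zero; *-distribˡ-sum; *-distribʳ-sum)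
  open import Relation.Binary.Reasoning.Setoid setoid

  private
    ∣H∣⁻¹ : Carrier
    ∣H∣⁻¹ = proj₁ ∣H∣-inverse

    ∣H∣⁻¹-central : ∀ x → ∣H∣⁻¹ * x ≈ x * ∣H∣⁻¹
    ∣H∣⁻¹-central = inverse-central R (proj₁ (proj₂ ∣H∣-inverse)) (proj₂ (proj₂ ∣H∣-inverse))
      (×1-central R order)

    ∣H∣⁻¹-cancel : ∀ x → ∣H∣⁻¹ * (order ×ᴿ x) ≈ x
    ∣H∣⁻¹-cancel x = begin
      ∣H∣⁻¹ * (order ×ᴿ x)         ≈⟨ *-congˡ (×1-* R order x) ⟨
      ∣H∣⁻¹ * ((order ×ᴿ 1#) * x)  ≈⟨ *-assoc _ _ _ ⟨
      ∣H∣⁻¹ * (order ×ᴿ 1#) * x    ≈⟨ *-congʳ (proj₁ (proj₂ ∣H∣-inverse)) ⟩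
      1# * x                      ≈⟨ *-identityˡ x ⟩
      x                           ∎

  OrbitConstant : Pred V ℓ
  OrbitConstant f = ∀ {i j} → j ∈ˢ orbit i → f j ≈ f i

  module _ {f : V} (const : OrbitConstant f) where

    constant-◃ : ∀ h j → f (element h ⟨$⟩ˡ j) ≈ f j
    -- `element h` carries `element h ⟨$⟩ˡ j` to `j`, so `j` lies in the orbit of that point.
    constant-◃ h j = sym (const (orbit⁺ H h (inverseʳ (element h))))

    -- All |H| terms of the average agree. With `Vθ-constant` this identifies `Vθ` with the
    -- orbit-constant vectors.
    θ-fixes-constant : f ≋ f θ
    θ-fixes-constant j = sym (begin
      ∣H∣⁻¹ * ∑[ h < order ] f (element h ⟨$⟩ˡ j)  ≈⟨ *-congˡ (sum-cong-≋ (λ h → constant-◃ h j)) ⟩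
      ∣H∣⁻¹ * ∑[ h < order ] f j                  ≈⟨ *-congˡ (sum-replicate order) ⟩
      ∣H∣⁻¹ * (order ×ᴿ f j)                      ≈⟨ ∣H∣⁻¹-cancel (f j) ⟩
      f j                                        ∎)

    θ-*-constant : ∀ u j → (u θ) j * f j ≈ ((λ k → u k * f k) θ) j
    θ-*-constant u j = begin
      ∣H∣⁻¹ * ∑[ h < order ] u (element h ⟨$⟩ˡ j) * f j
        ≈⟨ *-assoc _ _ _ ⟩
      ∣H∣⁻¹ * (∑[ h < order ] u (element h ⟨$⟩ˡ j) * f j)
        ≈⟨ *-congˡ (*-distribʳ-sum {n = order} (f j) _) ⟩
      ∣H∣⁻¹ * ∑[ h < order ] (u (element h ⟨$⟩ˡ j) * f j)
        ≈⟨ *-congˡ (sum-cong-≋ (λ h → *-congˡ (constant-◃ h j))) ⟨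
      ∣H∣⁻¹ * ∑[ h < order ] (u (element h ⟨$⟩ˡ j) * f (element h ⟨$⟩ˡ j)) ∎

    -- The mirror image of `θ-*-constant`; here the factor 1/|H| stands between `f j` and the sum,
    -- so its centrality is used.
    constant-*-θ : ∀ u j → f j * (u θ) j ≈ ((λ k → f k * u k) θ) j
    constant-*-θ u j = begin
      f j * (∣H∣⁻¹ * ∑[ h < order ] u (element h ⟨$⟩ˡ j))
        ≈⟨ *-assoc _ _ _ ⟨
      f j * ∣H∣⁻¹ * ∑[ h < order ] u (element h ⟨$⟩ˡ j)
        ≈⟨ *-congʳ (∣H∣⁻¹-central (f j)) ⟨
      ∣H∣⁻¹ * f j * ∑[ h < order ] u (element h ⟨$⟩ˡ j)
        ≈⟨ *-assoc _ _ _ ⟩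
      ∣H∣⁻¹ * (f j * ∑[ h < order ] u (element h ⟨$⟩ˡ j))
        ≈⟨ *-congˡ (*-distribˡ-sum {n = order} (f j) _) ⟩
      ∣H∣⁻¹ * ∑[ h < order ] (f j * u (element h ⟨$⟩ˡ j))
        ≈⟨ *-congˡ (sum-cong-≋ (λ h → *-congʳ (constant-◃ h j))) ⟨
      ∣H∣⁻¹ * ∑[ h < order ] (f (element h ⟨$⟩ˡ j) * u (element h ⟨$⟩ˡ j)) ∎

    -- Expand `f` in orbit vectors and interchange the sums: the entries of the `i`-th orbit vector
    -- add up to `m i`.
    sum-constant : sum f ≈ ∑[ i < t ] (m i ×ᴿ f (α i))
    sum-constant = begin
      ∑[ j < n ] f j
        ≈⟨ sum-cong-≋ (λ j → trans (const (proj₂ (cover j)))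
             (sym (evaluate (λ i → f (α i)) (proj₂ (cover j))))) ⟩
      ∑[ j < n ] ∑[ i < t ] (f (α i) * orbitVector i j)
        ≈⟨ ∑-comm (λ j i → f (α i) * orbitVector i j) ⟩
      ∑[ i < t ] ∑[ j < n ] (f (α i) * orbitVector i j)
        ≈⟨ sum-cong-≋ (λ i → *-distribˡ-sum (f (α i)) (orbitVector i)) ⟨
      ∑[ i < t ] (f (α i) * ∑[ j < n ] orbitVector i j)
        ≈⟨ sum-cong-≋ (λ i → *-congˡ (sum-indicator R (orbit (α i)))) ⟩
      ∑[ i < t ] (f (α i) * (m i ×ᴿ 1#))
        ≈⟨ sum-cong-≋ (λ i → *-×1 R (m i) (f (α i))) ⟩
      ∑[ i < t ] (m i ×ᴿ f (α i)) ∎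

  sum-θ : ∀ v → sum (v θ) ≈ sum v
  sum-θ v = begin
    ∑[ j < n ] (∣H∣⁻¹ * ∑[ h < order ] (v ◃ element h) j)
      ≈⟨ *-distribˡ-sum {n = n} ∣H∣⁻¹ _ ⟨
    ∣H∣⁻¹ * ∑[ j < n ] ∑[ h < order ] (v ◃ element h) j
      ≈⟨ *-congˡ (∑-comm (λ j h → (v ◃ element h) j)) ⟩
    ∣H∣⁻¹ * ∑[ h < order ] ∑[ j < n ] (v ◃ element h) j
      -- Each translate only rearranges the entries of `v`. The permutation is flipped because `◃`
      -- reads `v` at preimages.
      ≈⟨ *-congˡ (sum-cong-≋ (λ h → ∑-permute v (flip (element h)))) ⟨
    ∣H∣⁻¹ * ∑[ h < order ] sum v
      ≈⟨ *-congˡ (sum-replicate order) ⟩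
    ∣H∣⁻¹ * (order ×ᴿ sum v)
      ≈⟨ ∣H∣⁻¹-cancel (sum v) ⟩
    sum v ∎

  -- Multiplication by an orbit-constant vector commutes with `θ`, so the left side is the
  -- coordinate sum of an averaged vector, to which `sum-θ` applies.
  ⟨θ,constant⟩ : ∀ u {f} → OrbitConstant f → ⟨ u θ , f ⟩ ≈ ⟨ u , f ⟩
  ⟨θ,constant⟩ u const = trans (sum-cong-≋ (θ-*-constant const u)) (sum-θ _)

  ⟨constant,θ⟩ : ∀ {f} → OrbitConstant f → ∀ u → ⟨ f , u θ ⟩ ≈ ⟨ f , u ⟩
  ⟨constant,θ⟩ const u = trans (sum-cong-≋ (constant-*-θ const u)) (sum-θ _)

  ⟨,⟩-constant : ∀ {f g} → OrbitConstant f → OrbitConstant g →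
                 ⟨ f , g ⟩ ≈ ∑[ i < t ] (m i ×ᴿ (f (α i) * g (α i)))
  ⟨,⟩-constant f-const g-const = sum-constant (λ j∈ → *-cong (f-const j∈) (g-const j∈))

  -- This reduces pairing with an averaged codeword to pairings with translates of the codeword,
  -- where invariance of the code can be used.
  ⟨,θ⟩ : ∀ w c → ⟨ w , c θ ⟩ ≈ ∣H∣⁻¹ * ∑[ h < order ] ⟨ w , c ◃ element h ⟩
  ⟨,θ⟩ w c = begin
    ∑[ j < n ] (w j * (∣H∣⁻¹ * ∑[ h < order ] c′ h j))
      ≈⟨ sum-cong-≋ (λ j → trans (sym (*-assoc _ _ _))
           (trans (*-congʳ (sym (∣H∣⁻¹-central (w j)))) (*-assoc _ _ _))) ⟩
    ∑[ j < n ] (∣H∣⁻¹ * (w j * ∑[ h < order ] c′ h j))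
      ≈⟨ *-distribˡ-sum {n = n} ∣H∣⁻¹ _ ⟨
    ∣H∣⁻¹ * ∑[ j < n ] (w j * ∑[ h < order ] c′ h j)
      ≈⟨ *-congˡ (sum-cong-≋ (λ j → *-distribˡ-sum (w j) (λ h → c′ h j))) ⟩
    ∣H∣⁻¹ * ∑[ j < n ] ∑[ h < order ] (w j * c′ h j)
      ≈⟨ *-congˡ (∑-comm (λ j h → w j * c′ h j)) ⟩
    ∣H∣⁻¹ * ∑[ h < order ] ∑[ j < n ] (w j * c′ h j) ∎
    where
    c′ : Fin order → V
    c′ h = c ◃ element h

  -- Orbit lengths are invertible in `R`.

  unitVector : Fin n → V
  unitVector i j = if does (i ≟ᶠ j) then 1# else 0#

  private
    unitVector-diag : ∀ i → unitVector i i ≡ 1#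
    unitVector-diag i = ≡.cong (if_then 1# else 0#) (dec-true (i ≟ᶠ i) ≡.refl)

    unitVector-off : ∀ {i j} → i ≢ j → unitVector i j ≡ 0#
    unitVector-off {i} {j} i≢j = ≡.cong (if_then 1# else 0#) (dec-false (i ≟ᶠ j) i≢j)

  ⟨unitVector,⟩ : ∀ i f → ⟨ unitVector i , f ⟩ ≈ f i
  ⟨unitVector,⟩ i f = trans
    (sum-only (λ j → unitVector i j * f j) i
      (λ j≢i → trans (*-congʳ (reflexive (unitVector-off (λ i≡j → j≢i (≡.sym i≡j))))) (zeroˡ _)))
    (trans (*-congʳ (reflexive (unitVector-diag i))) (*-identityˡ _))

  index-unique : ∀ {i j} → j ∈ˢ orbit (α i) → index j ≡ i
  index-unique {j = j} j∈ = disjoint (proj₂ (cover j)) j∈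

  index-constant : ∀ {i j} → j ∈ˢ orbit i → index j ≡ index i
  index-constant {i} {j} j∈ = index-unique j∈αi
    where
    j∈αi : j ∈ˢ orbit (α (index i))
    j∈αi with orbit⁻ H j∈ | orbit⁻ H (proj₂ (cover i))
    -- `a` takes the representative `α (index i)` to `i` and `b` takes `i` to `j`, so the product
    -- "first `a`, then `b`" places `j` in the orbit of that representative.
    ... | b , ≡.refl | a , a≡ = orbit⁺ H (proj₁ ab)
      (≡.trans (proj₂ ab (α (index i))) (≡.cong (element b ⟨$⟩ʳ_) a≡))
      where ab = PermutationGroup.∘-closed H a b

  -- The entry at `j` is the Kronecker delta of `i` and `index j`, and `index` is constant on
  -- orbits.
  orbitVector-constant : ∀ i → OrbitConstant (orbitVector i)
  orbitVector-constant i {k} {j} j∈ = trans (by-index j) (trans (reflexive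
    (≡.cong (unit i) (index-constant j∈))) (sym (by-index k)))
    where
    unit : Fin t → Fin t → Carrier
    unit i l = if does (i ≟ᶠ l) then 1# else 0#

    by-index : ∀ j → orbitVector i j ≈ unit i (index j)
    by-index j with i ≟ᶠ index j
    ... | yes ≡.refl = reflexive (≡.cong (if_then 1# else 0#)
                         (dec-true (j ∈? orbit (α i)) (proj₂ (cover j))))
    ... | no  i≢     = reflexive (≡.cong (if_then 1# else 0#)
                         (dec-false (j ∈? orbit (α i)) (λ j∈i → i≢ (≡.sym (index-unique j∈i)))))

  -- Unfolded, this is the order of the stabilizer of `α i` divided by |H|, the value that
  -- orbit-stabilizer predicts for 1/`m i`. Writing it as an average makes the inverse law a
  -- consequence of `⟨θ,constant⟩`.
  m⁻¹ : Fin t → Carrier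
  m⁻¹ i = (unitVector (α i) θ) (α i)

  m⁻¹-inverseˡ : ∀ i → m⁻¹ i * (m i ×ᴿ 1#) ≈ 1#
  m⁻¹-inverseˡ i = begin
    m⁻¹ i * (m i ×ᴿ 1#)                    ≈⟨ *-congˡ (sum-indicator R (orbit (α i))) ⟨
    m⁻¹ i * ∑[ j < n ] orbitVector i j     ≈⟨ *-distribˡ-sum (m⁻¹ i) (orbitVector i) ⟩
    -- On the orbit, the averaged unit vector has the constant value `m⁻¹ i`; off the orbit,
    -- `orbitVector i` kills both sides.
    ∑[ j < n ] (m⁻¹ i * orbitVector i j)   ≈⟨ sum-cong-≋ on-orbit ⟩
    ⟨ unitVector (α i) θ , orbitVector i ⟩ ≈⟨ ⟨θ,constant⟩ (unitVector (α i)) (orbitVector-constant i) ⟩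
    ⟨ unitVector (α i) , orbitVector i ⟩   ≈⟨ ⟨unitVector,⟩ (α i) (orbitVector i) ⟩
    orbitVector i (α i)                    ≡⟨ ≡.cong (if_then 1# else 0#)
                                                (dec-true (α i ∈? orbit (α i)) (orbit-refl H)) ⟩
    1#                                     ∎
    where
    on-orbit : ∀ j → m⁻¹ i * orbitVector i j ≈ (unitVector (α i) θ) j * orbitVector i j
    on-orbit j with j ∈? orbit (α i)
    ... | yes j∈ = *-congʳ (sym (θ-constant (unitVector (α i)) j∈))
    ... | no  _  = trans (zeroʳ _) (sym (zeroʳ _))

  ·ᴹ-diag : ∀ y d j → (y ·ᴹ diag d) j ≈ y j * d j
  ·ᴹ-diag y d j = trans
    (sum-only (λ i → y i * diag d i j) j (λ {i} i≢j → trans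
      (*-congˡ (reflexive (≡.cong (if_then d i else 0#) (dec-false (i ≟ᶠ j) i≢j)))) (zeroʳ _)))
    (*-congˡ (reflexive (≡.cong (if_then d j else 0#) (dec-true (j ≟ᶠ j) ≡.refl))))

  Vθ-constant : ∀ {v} → v ∈ Vθ → OrbitConstant v
  Vθ-constant (x , _ , v≋) {i} {j} j∈ = trans (v≋ j) (trans (θ-constant x j∈) (sym (v≋ i)))

  -- The two inclusions.

  module _ {p} {C : Pred V p} where

    ⊥ᴴ⊆⊥θM : ⊥ᴴ (C θˢ) (Xθ⊆Vθ C) ⊆ ((⊥ C) θˢ) ·ˢ orbitLengthMatrix
    ⊥ᴴ⊆⊥θM {v} (v∈ , v⊥) = w , (w , w⊥ , θ-fixes-constant w-const) , v≋wM
      where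
      w : V
      -- Undo `M_H` by dividing each entry by its orbit length, on the right because `·ᴹ` multiplies
      -- there. Being orbit-constant, `w` is its own preimage under `θ`.
      w j = v j * m⁻¹ (index j)

      w-const : OrbitConstant w
      w-const j∈ = *-cong (Vθ-constant v∈ j∈) (reflexive (≡.cong m⁻¹ (index-constant j∈)))

      w-rescaled : ∀ i x → m i ×ᴿ (w (α i) * x) ≈ v (α i) * x
      w-rescaled i x = begin
        m i ×ᴿ (w (α i) * x)                     ≈⟨ ×-assoc-* (m i) _ x ⟨
        (m i ×ᴿ w (α i)) * x                     ≈⟨ *-congʳ (*-×1 R (m i) _) ⟨
        v (α i) * m⁻¹ (index (α i)) * (m i ×ᴿ 1#) * x
          ≡⟨ ≡.cong (λ l → v (α i) * m⁻¹ l * (m i ×ᴿ 1#) * x) (index-unique (orbit-refl H)) ⟩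
        v (α i) * m⁻¹ i * (m i ×ᴿ 1#) * x         ≈⟨ *-congʳ (*-assoc _ _ _) ⟩
        v (α i) * (m⁻¹ i * (m i ×ᴿ 1#)) * x       ≈⟨ *-congʳ (*-congˡ (m⁻¹-inverseˡ i)) ⟩
        v (α i) * 1# * x                         ≈⟨ *-congʳ (*-identityʳ _) ⟩
        v (α i) * x                              ∎

      w⊥ : w ∈ ⊥ C
      w⊥ {c} c∈ = begin
        ⟨ w , c ⟩                                    ≈⟨ ⟨constant,θ⟩ w-const c ⟨
        ⟨ w , c θ ⟩                                  ≈⟨ ⟨,⟩-constant w-const (θ-constant c) ⟩
        ∑[ i < t ] (m i ×ᴿ (w (α i) * (c θ) (α i)))  ≈⟨ sum-cong-≋ (λ i → w-rescaled i _) ⟩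
        -- `decompose` takes the values at the representatives as coefficients, so this sum is by
        -- definition the `H`-inner product of `v` and `c θ`.
        ∑[ i < t ] (v (α i) * (c θ) (α i))           ≈⟨ v⊥ (c , c∈ , λ _ → refl) ⟩
        0#                                           ∎

      v≋wM : v ≋ w ·ᴹ orbitLengthMatrix
      v≋wM j = sym (begin
        (w ·ᴹ orbitLengthMatrix) j                        ≈⟨ ·ᴹ-diag w _ j ⟩
        v j * m⁻¹ (index j) * (m (index j) ×ᴿ 1#)          ≈⟨ *-assoc _ _ _ ⟩
        v j * (m⁻¹ (index j) * (m (index j) ×ᴿ 1#))        ≈⟨ *-congˡ (m⁻¹-inverseˡ (index j)) ⟩
        v j * 1#                                          ≈⟨ *-identityʳ _ ⟩
        v j                                               ∎)

    -- `M_H` supplies exactly the weights `m i` that turn the `H`-inner product of `v` and `c θ`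
    -- into the ordinary pairing of `w θ` and `c θ`. One average is then absorbed by the other, and
    -- the remaining one is spread over translates of `c`.
    ⊥θM⊆⊥ᴴ : Invariant H C → ((⊥ C) θˢ) ·ˢ orbitLengthMatrix ⊆ ⊥ᴴ (C θˢ) (Xθ⊆Vθ C)
    ⊥θM⊆⊥ᴴ inv {v} (y , (w , w⊥ , y≋) , v≋) = (v , tt , θ-fixes-constant v-const) , v⊥
      where
      v-value : ∀ j → v j ≈ (w θ) j * (m (index j) ×ᴿ 1#)
      v-value j = trans (v≋ j) (trans (·ᴹ-diag y _ j) (*-congʳ (y≋ j)))

      v-const : OrbitConstant v
      v-const {i} {j} j∈ = trans (v-value j) (trans
        (*-cong (θ-constant w j∈) (reflexive (≡.cong (λ l → m l ×ᴿ 1#) (index-constant j∈))))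
        (sym (v-value i)))

      v-at-α : ∀ i → v (α i) ≈ m i ×ᴿ (w θ) (α i)
      v-at-α i = begin
        v (α i)                                   ≈⟨ v-value (α i) ⟩
        (w θ) (α i) * (m (index (α i)) ×ᴿ 1#)
          ≡⟨ ≡.cong (λ l → (w θ) (α i) * (m l ×ᴿ 1#)) (index-unique (orbit-refl H)) ⟩
        (w θ) (α i) * (m i ×ᴿ 1#)                  ≈⟨ *-×1 R (m i) _ ⟩
        m i ×ᴿ (w θ) (α i)                        ∎

      v⊥ : ∀ {u} → u ∈ C θˢ → ∑[ i < t ] (v (α i) * u (α i)) ≈ 0#
      v⊥ {u} (c , c∈ , u≋) = begin
        ∑[ i < t ] (v (α i) * u (α i))
          ≈⟨ sum-cong-≋ (λ i → trans (*-cong (v-at-α i) (u≋ (α i))) (×-assoc-* (m i) _ _)) ⟩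
        ∑[ i < t ] (m i ×ᴿ ((w θ) (α i) * (c θ) (α i)))
          ≈⟨ ⟨,⟩-constant (θ-constant w) (θ-constant c) ⟨
        ⟨ w θ , c θ ⟩
          ≈⟨ ⟨θ,constant⟩ w (θ-constant c) ⟩
        ⟨ w , c θ ⟩
          ≈⟨ ⟨,θ⟩ w c ⟩
        ∣H∣⁻¹ * ∑[ h < order ] ⟨ w , c ◃ element h ⟩
          -- Invariance enters here: every translate `c ◃ element h` is again in `C`, hence
          -- orthogonal to `w`.
          ≈⟨ *-congˡ (sum-cong-≋ (λ h → w⊥ (inv {element h} (h , λ _ → ≡.refl) {c} c∈))) ⟩
        ∣H∣⁻¹ * ∑[ h < order ] 0#
          ≈⟨ *-congˡ (sum-replicate-zero order) ⟩
        ∣H∣⁻¹ * 0#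
          ≈⟨ zeroʳ _ ⟩
        0# ∎

theorem3p3 : ∀ {c ℓ p} (R : Ring c ℓ) → IsFinite R → IsFrobenius R →
    (n : ℕ) (G H : PermutationGroup n) → H ≤ᴳ G →
    (∣H∣-inverse : HasInverseIn R (PermutationGroup.order H)) (orbits : Orbits H) →
    let open Codes R n
        open HCodes R H ∣H∣-inverse orbits in
    (C : Pred V p) → IsLeftCode G C ⊎ IsRightCode G C →
    ⊥ᴴ (C θˢ) (Xθ⊆Vθ C) ≐ ((⊥ C) θˢ) ·ˢ orbitLengthMatrix
theorem3p3 R _ _ n G H H≤G ∣H∣-inverse orbits C code =
  ⊥ᴴ⊆⊥θM R H ∣H∣-inverse orbits ,
  ⊥θM⊆⊥ᴴ R H ∣H∣-inverse orbits (λ {h} h∈H {v} → invariant code {h} (H≤G {h} h∈H) {v})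
  where
  open Codes R n

  invariant : IsLeftCode G C ⊎ IsRightCode G C → Invariant G C
  invariant (inj₁ (_ , inv)) {g} g∈G {v} = inv {g} g∈G {v}
  invariant (inj₂ (_ , inv)) {g} g∈G {v} = inv {g} g∈G {v}
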